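{- Let $m \geq 2$ be an integer and let $S$ be a minimal zero-sum multiset in $\mathbb{Z}/m\mathbb{Z}$. (i) If $\#S + \sigma(S) = m+1$, then $\sigma(S) \leq 2$, except when $m = 6$ and $S$ is the multiset $(1,3,4,4)$ or the multiset $(2,2,3,5)$ (of residue classes mod $6$). (ii) If $m \geq 3$, $m \neq 6$, and $\#S + \sigma(S) = m+1$, then $S$ contains an element $a$ of multiplicity $\mu(a) \geq m-2$. (iii) If $m \geq 7$ and $\sigma(S) \geq 3$, then $\#S \leq m - \sigma(S)$.
   Context: A finite multiset $S$ in an abelian group $M$ consists of a finite support $\operatorname{supp}(S) \subseteq M$ and a multiplicity $\mu(a) \geq 1$ for each $a \in \operatorname{supp}(S)$. Its sum is $\Sigma(S) = \sum_{a \in \operatorname{supp}(S)} \mu(a)\, a \in M$, its size is $\#S = \sum_{a \in \operatorname{supp}(S)} \mu(a)$ (elements counted with multiplicity), and its width is $\sigma(S) = \#\operatorname{supp}(S)$ (number of different elements). $S$ is a zero-sum multiset if $\Sigma(S) = 0$; it is a minimal zero-sum multiset if it is a nonempty zero-sum multiset and no proper nonempty submultiset has sum zero. -}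

module Defs where

open import Algebra.Bundles using (AbelianGroup)
import Algebra.Definitions.RawMonoid as RawMonoidOperations
open import Data.Fin.Base using (Fin; toℕ)
open import Data.Fin.Properties using (_≟_; toℕ-injective; toℕ-fromℕ<; toℕ<n; toℕ≤n)
open import Data.Fin.Subset using (Subset; ∣_∣)
open import Data.List.Base using (List; length; filter; map)
open import Data.Nat.Base using (ℕ; _+_; _∸_; _≤_; _<_; NonZero; +-0-rawMonoid)
open import Data.Nat.DivMod using (_%_; _mod_; m%n<n; m<n⇒m%n≡m; %-distribˡ-+; m%n%n≡m%n; n%n≡0; m*n%n≡0)
open import Data.Nat.Properties using (+-assoc; +-comm; +-identityʳ; m+[n∸m]≡n; _≤?_)
open import Data.Product.Base using (_×_; _,_; ∃-syntax)
open import Data.Vec.Base using (tabulate)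
open import Data.Vec.Functional using (Vector)
open import Level using (0ℓ)
open import Relation.Binary.PropositionalEquality
open import Relation.Nullary.Decidable using (does)
open import Relation.Nullary.Negation using (¬_)

module _ (m : ℕ) .{{_ : NonZero m}} where

  toℕ-mod : ∀ k → toℕ (k mod m) ≡ k % m
  toℕ-mod k = toℕ-fromℕ< (m%n<n k m)

  private
    _⊕_ : Fin m → Fin m → Fin m
    a ⊕ b = (toℕ a + toℕ b) mod m

    𝟘 : Fin m
    𝟘 = 0 mod m

    ⊖_ : Fin m → Fin m
    ⊖ a = (m ∸ toℕ a) mod m

    mod-cong : ∀ {j k} → j % m ≡ k % m → j mod m ≡ k mod m
    mod-cong {j} {k} eq =
      toℕ-injective (trans (toℕ-mod j) (trans eq (sym (toℕ-mod k))))

    mod-toℕ : ∀ a → toℕ a mod m ≡ a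
    mod-toℕ a = toℕ-injective (trans (toℕ-mod (toℕ a)) (m<n⇒m%n≡m (toℕ<n a)))

    %-+ˡ : ∀ j k → (j % m + k) % m ≡ (j + k) % m
    %-+ˡ j k = begin
      (j % m + k) % m          ≡⟨ %-distribˡ-+ (j % m) k m ⟩
      (j % m % m + k % m) % m  ≡⟨ cong (λ x → (x + k % m) % m) (m%n%n≡m%n j m) ⟩
      (j % m + k % m) % m      ≡⟨ %-distribˡ-+ j k m ⟨
      (j + k) % m              ∎
      where open ≡-Reasoning

    mod-⊕ˡ : ∀ k a → (k mod m) ⊕ a ≡ (k + toℕ a) mod m
    mod-⊕ˡ k a = mod-cong
      (trans (cong (λ x → (x + toℕ a) % m) (toℕ-mod k)) (%-+ˡ k (toℕ a)))

    ⊕-comm : ∀ a b → a ⊕ b ≡ b ⊕ a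
    ⊕-comm a b = cong (_mod m) (+-comm (toℕ a) (toℕ b))

    ⊕-assoc : ∀ a b c → (a ⊕ b) ⊕ c ≡ a ⊕ (b ⊕ c)
    ⊕-assoc a b c = begin
      (a ⊕ b) ⊕ c                        ≡⟨ mod-⊕ˡ (toℕ a + toℕ b) c ⟩
      (toℕ a + toℕ b + toℕ c) mod m      ≡⟨ cong (_mod m) (+-assoc (toℕ a) (toℕ b) (toℕ c)) ⟩
      (toℕ a + (toℕ b + toℕ c)) mod m    ≡⟨ cong (_mod m) (+-comm (toℕ a) (toℕ b + toℕ c)) ⟩
      (toℕ b + toℕ c + toℕ a) mod m      ≡⟨ mod-⊕ˡ (toℕ b + toℕ c) a ⟨
      (b ⊕ c) ⊕ a                        ≡⟨ ⊕-comm (b ⊕ c) a ⟩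
      a ⊕ (b ⊕ c)                        ∎
      where open ≡-Reasoning

    ⊕-identityˡ : ∀ a → 𝟘 ⊕ a ≡ a
    ⊕-identityˡ a = trans (mod-⊕ˡ 0 a) (mod-toℕ a)

    ⊕-inverseʳ : ∀ a → a ⊕ (⊖ a) ≡ 𝟘
    ⊕-inverseʳ a = begin
      a ⊕ (⊖ a)                        ≡⟨ ⊕-comm a (⊖ a) ⟩
      (⊖ a) ⊕ a                        ≡⟨ mod-⊕ˡ (m ∸ toℕ a) a ⟩
      (m ∸ toℕ a + toℕ a) mod m        ≡⟨ cong (_mod m) (+-comm (m ∸ toℕ a) (toℕ a)) ⟩
      (toℕ a + (m ∸ toℕ a)) mod m      ≡⟨ cong (_mod m) (m+[n∸m]≡n (toℕ≤n a)) ⟩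
      m mod m                          ≡⟨ mod-cong (trans (n%n≡0 m) (sym (m*n%n≡0 0 m))) ⟩
      𝟘                                ∎
      where open ≡-Reasoning

  ℤ/ : AbelianGroup 0ℓ 0ℓ
  ℤ/ = record
    { Carrier = Fin m
    ; _≈_     = _≡_
    ; _∙_     = _⊕_
    ; ε       = 𝟘
    ; _⁻¹     = ⊖_
    ; isAbelianGroup = record
      { isGroup = record
        { isMonoid = record
          { isSemigroup = record
            { isMagma = record { isEquivalence = isEquivalence ; ∙-cong = cong₂ _⊕_ }
            ; assoc   = ⊕-assoc
            }
          ; identity = ⊕-identityˡ , λ a → trans (⊕-comm a 𝟘) (⊕-identityˡ a)
          }
        ; inverse = (λ a → trans (⊕-comm (⊖ a) a) (⊕-inverseʳ a)) , ⊕-inverseʳ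
        ; ⁻¹-cong = cong ⊖_
        }
      ; comm = ⊕-comm
      }
    }

-- A multiset in ℤ/m is given by its multiplicity function, extended by 0
-- outside the support.  Finiteness is automatic, and summing over all of ℤ/m
-- is the same as summing over the support.
Multiset : ℕ → Set
Multiset m = Vector ℕ m

module _ {m : ℕ} where

  supp : Multiset m → Subset m
  supp S = tabulate (λ a → does (1 ≤? S a))

  σ : Multiset m → ℕ
  σ S = ∣ supp S ∣

  #_ : Multiset m → ℕ
  # S = RawMonoidOperations.sum +-0-rawMonoid S

  Nonempty : Multiset m → Set
  Nonempty S = ∃[ a ] 1 ≤ S a

  infix 4 _⊆_ _⊂_

  _⊆_ : Multiset m → Multiset m → Set
  T ⊆ S = ∀ a → T a ≤ S a

  _⊂_ : Multiset m → Multiset m → Set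
  T ⊂ S = T ⊆ S × ∃[ a ] T a < S a

module _ {m : ℕ} .{{_ : NonZero m}} where

  open AbelianGroup (ℤ/ m) using (Carrier; _≈_; ε; rawMonoid)
  open RawMonoidOperations rawMonoid using (sum) renaming (_×_ to _·_)

  Σ[_] : Multiset m → Carrier
  Σ[ S ] = sum (λ a → S a · a)

  ZeroSum : Multiset m → Set
  ZeroSum S = Σ[ S ] ≈ ε

  MinimalZeroSum : Multiset m → Set
  MinimalZeroSum S =
    Nonempty S × ZeroSum S × (∀ T → T ⊂ S → Nonempty T → ¬ ZeroSum T)

  -- The multiset of the residue classes mod m of a list of integers.
  ⟅_⟆ : List ℕ → Multiset m
  ⟅ ks ⟆ a = length (filter (a ≟_) (map (_mod m) ks))

{-# OPTIONS --safe #-}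
module Submission where

-- Remove one element x from S.  If V lists the support of S, the rest is a
-- zero-sum free sequence W ++ V, and each element prepended to V enlarges the
-- set of subset sums by at least one (the total sum is new), so that set has at
-- least |W| plus the number of subset sums of V elements.  Of two distinct
-- elements c and d, one enlarges the set of subset sums by two, which gives
-- 2k + 1 subset sums for a zero-sum free set of k ≥ 4 elements and hence
-- #S + σ(S) ≤ m.  A set of three elements has at least 7 subset sums, which
-- again suffices, unless it is {h, r, h + r} with 2h = 0.  In that case the
-- subset sums are invariant under h and grow in steps of two, which leaves only
-- m = 6 and #S = 4.  If S is squarefree, i.e. no x can be removed without
-- shrinking the support, the elements and their negatives already give 2k
-- distinct classes, because ℤ/m has at most one element of order two.
-- If σ(S) = 2 and both multiplicities are at least two, then the 7 subset sums
-- of a, b, a, b give #S + 2 ≤ m in the same way, or S is that sequence and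
-- 2(a + b) = 0 with m = 5.

open import Defs
open import Algebra.Bundles using (AbelianGroup)
open import Algebra.Core using (Op₁; Op₂)
import Algebra.Definitions.RawMonoid as RawMonoidOperations
import Algebra.Properties.CommutativeMonoid.Sum as CommutativeMonoidSum
import Algebra.Properties.Group as GroupProperties
import Algebra.Solver.CommutativeMonoid as CommutativeMonoidSolver
open import Algebra.Structures using (IsAbelianGroup)
open import Data.Fin.Base using (Fin; zero; suc; toℕ; punchIn)
open import Data.Fin.Patterns using (0F)
open import Data.Fin.Properties using (_≟_; any?; all?; injective⇒≤; toℕ-injective; toℕ<n; punchInᵢ≢i) renaming (suc-injective to Fin-suc-injective)
open import Data.Fin.Subset using (_∈_; ∣_∣)
open import Data.List.Base using (List; []; _∷_; _++_; map; length; foldr; lookup; filter; replicate)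
open import Data.List.Membership.Propositional using (find) renaming (_∈_ to _∈ₗ_)
open import Data.List.Membership.Propositional.Properties using (∈-map⁻; ∈-∃++; ∈-lookup)
open import Data.List.Properties using (length-++; length-map; length-replicate; filter-++; filter-accept; filter-reject; filter-all; filter-none)
open import Data.List.Relation.Binary.Permutation.Propositional using (_↭_; refl; prep; swap; ↭-sym; ↭-trans) renaming (trans to ↭-compose)
open import Data.List.Relation.Binary.Permutation.Propositional.Properties using (shift; shifts; ↭-length; All-resp-↭; ∈-resp-↭; filter-↭; ++⁺ˡ; ++⁺ʳ)
open import Data.List.Relation.Unary.All as All using (All; []; _∷_)
open import Data.List.Relation.Unary.All.Properties using (¬All⇒Any¬; ¬Any⇒All¬) renaming (++⁺ to All-++⁺; replicate⁺ to All-replicate⁺)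
open import Data.List.Relation.Unary.AllPairs using ([]; _∷_)
open import Data.List.Relation.Unary.Any using (here; there)
open import Data.List.Relation.Unary.Unique.Propositional using (Unique)
import Data.List.Relation.Unary.Unique.Propositional.Properties as Uniqueₚ
open import Data.Nat.Base as ℕ using (ℕ; zero; suc; _+_; _∸_; _*_; _⊓_; pred; _≤_; _<_; _≥_; s≤s; z≤n; NonZero)
open import Data.Nat.Divisibility using (divides; m%n≡0⇒n∣m)
open import Data.Nat.DivMod using (m*n%n≡0)
open import Data.Nat.Properties as ℕₚ hiding (_≟_)
open import Data.Nat.Tactic.RingSolver using (solve-∀)
open import Data.Product.Base using (_×_; _,_; proj₁; proj₂; ∃-syntax; ∃₂)
open import Data.Sum.Base using (_⊎_; inj₁; inj₂)
open import Data.Unit.Base using (⊤)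
open import Data.Vec.Base using (tabulate)
open import Data.Vec.Functional using (Vector)
open import Data.Vec.Properties using (tabulate-cong; lookup⇒[]=; lookup∘tabulate)
open import Function.Base using (_∘_; id)
open import Function.Bundles using (_⇔_; mk⇔)
open import Relation.Binary.Definitions using (tri<; tri≈; tri>)
open import Relation.Binary.PropositionalEquality
open import Relation.Nullary.Decidable using (Dec; yes; no; does; dec-true; from-yes; decidable-stable; _×-dec_; _⊎-dec_; _→-dec_; ¬?)
open import Relation.Nullary.Negation using (¬_; contradiction)

-- Lists without repetition.

lookup-injective : ∀ {A : Set} {xs : List A} → Unique xs → ∀ i j → lookup xs i ≡ lookup xs j → i ≡ j
lookup-injective (px ∷ u) Fin.zero Fin.zero eq = refl
lookup-injective {xs = x ∷ xs} (px ∷ u) Fin.zero (Fin.suc j) eq =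
  contradiction eq (All.lookup px (∈-lookup {xs = xs} j))
lookup-injective {xs = x ∷ xs} (px ∷ u) (Fin.suc i) Fin.zero eq =
  contradiction (sym eq) (All.lookup px (∈-lookup {xs = xs} i))
lookup-injective (px ∷ u) (Fin.suc i) (Fin.suc j) eq = cong Fin.suc (lookup-injective u i j eq)

Unique⇒length≤ : ∀ {m} {xs : List (Fin m)} → Unique xs → length xs ≤ m
Unique⇒length≤ u = injective⇒≤ (λ {i} {j} → lookup-injective u i j)

Unique-↭ : ∀ {A : Set} {xs ys : List A} → xs ↭ ys → Unique xs → Unique ys
Unique-↭ refl u = u
Unique-↭ (prep x p) (px ∷ u) = All-resp-↭ p px ∷ Unique-↭ p u
Unique-↭ (swap x y p) ((x≢y ∷ px) ∷ py ∷ u) =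
  (≢-sym x≢y ∷ All-resp-↭ p py) ∷ All-resp-↭ p px ∷ Unique-↭ p u
Unique-↭ (↭-compose p q) u = Unique-↭ q (Unique-↭ p u)

∈⇒↭ : ∀ {A : Set} {x : A} {xs} → x ∈ₗ xs → ∃[ ys ] xs ↭ x ∷ ys
∈⇒↭ {x = x} x∈xs with ys , zs , refl ← ∈-∃++ x∈xs = ys ++ zs , shift x ys zs

-- Subset sums and zero-sum free sequences in an abelian group on `Fin m`.

module SubsetSums {m} {_⊞_ : Op₂ (Fin m)} {0# : Fin m} { -_ : Op₁ (Fin m)}
                  (isAbelianGroup : IsAbelianGroup _≡_ _⊞_ 0# -_) where

  private
    G : AbelianGroup _ _
    G = record { isAbelianGroup = isAbelianGroup }

  open AbelianGroup G using (group; commutativeMonoid; comm; assoc; identityˡ; identityʳ; inverseʳ; inverseˡ)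
  open GroupProperties group using (∙-cancelˡ; ∙-cancelʳ; ⁻¹-injective)
  open CommutativeMonoidSolver commutativeMonoid using (solve; _⊕_; _⊜_) renaming (id to ⓪)

  Σₗ : List (Fin m) → Fin m
  Σₗ = foldr _⊞_ 0#

  SubSum : List (Fin m) → Fin m → Set
  SubSum []      g = g ≡ 0#
  SubSum (c ∷ L) g = SubSum L g ⊎ ∃[ g′ ] (SubSum L g′ × g ≡ c ⊞ g′)

  -- A nonempty subsequence is split at its first element, so only sums `c ⊞ g` with `g` a subset
  -- sum of the tail have to avoid zero.
  ZeroSumFree : List (Fin m) → Set
  ZeroSumFree []      = ⊤
  ZeroSumFree (c ∷ L) = ZeroSumFree L × (∀ g → SubSum L g → c ⊞ g ≢ 0#)

  subSum? : ∀ L g → Dec (SubSum L g)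
  subSum? []      g = g ≟ 0#
  subSum? (c ∷ L) g = subSum? L g ⊎-dec any? (λ g′ → subSum? L g′ ×-dec (g ≟ c ⊞ g′))

  subSum-0 : ∀ L → SubSum L 0#
  subSum-0 []      = refl
  subSum-0 (c ∷ L) = inj₁ (subSum-0 L)

  subSum-Σ : ∀ L → SubSum L (Σₗ L)
  subSum-Σ []      = refl
  subSum-Σ (c ∷ L) = inj₂ (_ , subSum-Σ L , refl)

  subSum-∈ : ∀ {L v} → v ∈ₗ L → SubSum L v
  subSum-∈ {c ∷ L} (here refl) = inj₂ (0# , subSum-0 L , sym (identityʳ c))
  subSum-∈ (there v∈L) = inj₁ (subSum-∈ v∈L)

  -- The witness is the sum of the complementary subsequence.
  subSum-complement : ∀ L {g} → SubSum L g → ∃[ g′ ] (SubSum L g′ × g ⊞ g′ ≡ Σₗ L)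
  subSum-complement [] refl = 0# , refl , identityʳ 0#
  subSum-complement (c ∷ L) {g} (inj₁ s) with g′ , s′ , eq ← subSum-complement L s =
    c ⊞ g′ , inj₂ (g′ , s′ , refl) ,
    trans (solve 3 (λ g c g′ → g ⊕ (c ⊕ g′) ⊜ c ⊕ (g ⊕ g′)) refl g c g′) (cong (c ⊞_) eq)
  subSum-complement (c ∷ L) (inj₂ (x , s , refl)) with g′ , s′ , eq ← subSum-complement L s =
    g′ , inj₁ s′ , trans (assoc c x g′) (cong (c ⊞_) eq)

  subSum-↭ : ∀ {L K g} → L ↭ K → SubSum L g → SubSum K g
  subSum-↭ refl s = s
  subSum-↭ (prep x p) (inj₁ s) = inj₁ (subSum-↭ p s)
  subSum-↭ (prep x p) (inj₂ (g , s , eq)) = inj₂ (g , subSum-↭ p s , eq)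
  subSum-↭ (swap x y p) (inj₁ (inj₁ s)) = inj₁ (inj₁ (subSum-↭ p s))
  subSum-↭ (swap x y p) (inj₁ (inj₂ (g , s , eq))) = inj₂ (g , inj₁ (subSum-↭ p s) , eq)
  subSum-↭ (swap x y p) (inj₂ (g , inj₁ s , eq)) = inj₁ (inj₂ (g , subSum-↭ p s , eq))
  subSum-↭ (swap x y p) (inj₂ (_ , inj₂ (g , s , refl) , refl)) =
    inj₂ (_ , inj₂ (g , subSum-↭ p s , refl) ,
      solve 3 (λ x y g → x ⊕ (y ⊕ g) ⊜ y ⊕ (x ⊕ g)) refl x y g)
  subSum-↭ (↭-compose p q) s = subSum-↭ q (subSum-↭ p s)

  zeroSumFree-↭ : ∀ {L K} → L ↭ K → ZeroSumFree L → ZeroSumFree K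
  zeroSumFree-↭ refl z = z
  zeroSumFree-↭ (prep x p) (z , x+) = zeroSumFree-↭ p z , λ g s → x+ g (subSum-↭ (↭-sym p) s)
  zeroSumFree-↭ (swap x y p) ((z , y+) , x+) =
    (zeroSumFree-↭ p z , λ g s → x+ g (inj₁ (subSum-↭ (↭-sym p) s))) ,
    λ { g (inj₁ s) → y+ g (subSum-↭ (↭-sym p) s)
      ; _ (inj₂ (g , s , refl)) eq → x+ (y ⊞ g) (inj₂ (g , subSum-↭ (↭-sym p) s , refl))
          (trans (solve 3 (λ x y g → x ⊕ (y ⊕ g) ⊜ y ⊕ (x ⊕ g)) refl x y g) eq) }
  zeroSumFree-↭ (↭-compose p q) z = zeroSumFree-↭ q (zeroSumFree-↭ p z)

  zeroSumFree-drop : ∀ W {V} → ZeroSumFree (W ++ V) → ZeroSumFree V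
  zeroSumFree-drop []      z = z
  zeroSumFree-drop (w ∷ W) z = zeroSumFree-drop W (proj₁ z)

  Σ≢0 : ∀ {c L} → ZeroSumFree (c ∷ L) → c ⊞ Σₗ L ≢ 0#
  Σ≢0 {L = L} (_ , c+) = c+ _ (subSum-Σ L)

  head≢0 : ∀ {c L} → ZeroSumFree (c ∷ L) → c ≢ 0#
  head≢0 {c} {L} (_ , c+) c≡0 = c+ 0# (subSum-0 L) (trans (identityʳ c) c≡0)

  ∈⇒≢0 : ∀ {L v} → ZeroSumFree L → v ∈ₗ L → v ≢ 0#
  ∈⇒≢0 {L = c ∷ L} z (here refl) = head≢0 {c} {L} z
  ∈⇒≢0 z (there v∈L) = ∈⇒≢0 (proj₁ z) v∈L

  pair≢0 : ∀ {L v w} → ZeroSumFree L → v ∈ₗ L → w ∈ₗ L → v ≢ w → v ⊞ w ≢ 0#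
  pair≢0 z (here refl) (here refl) v≢w = contradiction refl v≢w
  pair≢0 (z , v+) (here refl) (there w∈L) _ = v+ _ (subSum-∈ w∈L)
  pair≢0 {v = v} {w} (z , w+) (there v∈L) (here refl) _ eq = w+ _ (subSum-∈ v∈L) (trans (comm w v) eq)
  pair≢0 (z , _) (there v∈L) (there w∈L) v≢w = pair≢0 z v∈L w∈L v≢w

  absorb : ∀ {a b} → a ⊞ b ≡ b → a ≡ 0#
  absorb {a} {b} eq = ∙-cancelʳ b a 0# (trans eq (sym (identityˡ b)))

  -- Otherwise the complement `g` of `c ⊞ Σₗ L` in `L` satisfies `c ⊞ g ≡ 0#`.
  Σ-new : ∀ {c L} → ZeroSumFree (c ∷ L) → ¬ SubSum L (c ⊞ Σₗ L)
  Σ-new {c} {L} (_ , c+) s with g , s′ , eq ← subSum-complement L s = c+ g s′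
    (absorb (trans (solve 3 (λ c g x → (c ⊕ g) ⊕ x ⊜ (c ⊕ x) ⊕ g) refl c g (Σₗ L)) eq))

  -- Growth of the set of subset sums.

  AtLeast : ℕ → List (Fin m) → Set
  AtLeast k L = ∃[ xs ] (Unique xs × All (SubSum L) xs × length xs ≡ k)

  atLeast⇒≤ : ∀ {k L} → AtLeast k L → k ≤ m
  atLeast⇒≤ (xs , u , _ , refl) = Unique⇒length≤ u

  atLeast-↭ : ∀ {k L K} → L ↭ K → AtLeast k L → AtLeast k K
  atLeast-↭ p (xs , u , s , l) = xs , u , All.map (subSum-↭ p) s , l

  New : Fin m → List (Fin m) → Fin m → Set
  New c L y = SubSum (c ∷ L) y × ¬ SubSum L y

  grow-by : ∀ {c L k} ys → Unique ys → All (New c L) ys → AtLeast k L → AtLeast (length ys + k) (c ∷ L)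
  grow-by ys uy new (xs , ux , s , refl) =
    ys ++ xs ,
    Uniqueₚ.++⁺ uy ux (λ (y∈ys , y∈xs) → proj₂ (All.lookup new y∈ys) (All.lookup s y∈xs)) ,
    All-++⁺ (All.map proj₁ new) (All.map inj₁ s) ,
    length-++ ys

  grow : ∀ {c L k} → ZeroSumFree (c ∷ L) → AtLeast k L → AtLeast (suc k) (c ∷ L)
  grow {c} {L} z = grow-by (_ ∷ []) ([] ∷ []) ((subSum-Σ (c ∷ L) , Σ-new {c} {L} z) ∷ [])

  grow-++ : ∀ W {V k} → ZeroSumFree (W ++ V) → AtLeast k V → AtLeast (length W + k) (W ++ V)
  grow-++ []      z a = a
  grow-++ (w ∷ W) z a = grow z (grow-++ W (proj₁ z) a)

  -- In a zero-sum free list the total `c ⊞ Σₗ L` is new by `Σ-new`, so one more new sum makes two.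
  TwoNew : Fin m → List (Fin m) → Set
  TwoNew c L = ∃[ y ] (y ≢ c ⊞ Σₗ L × New c L y)

  twoNew? : ∀ c L → Dec (TwoNew c L)
  twoNew? c L = any? (λ y → ¬? (y ≟ c ⊞ Σₗ L) ×-dec (subSum? (c ∷ L) y ×-dec ¬? (subSum? L y)))

  grow² : ∀ {c L k} → ZeroSumFree (c ∷ L) → TwoNew c L → AtLeast k L → AtLeast (2 + k) (c ∷ L)
  grow² {c} {L} z (y , y≢ , new) = grow-by (y ∷ _ ∷ []) ((y≢ ∷ []) ∷ [] ∷ [])
    (new ∷ (subSum-Σ (c ∷ L) , Σ-new {c} {L} z) ∷ [])

  -- If c contributes only the total sum, then the subset sums X of L satisfy
  -- X ∖ {0} ⊆ c ⊞ X.
  subtract : ∀ {c L x} → ZeroSumFree (c ∷ L) → ¬ TwoNew c L → SubSum L x → x ≢ 0# →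
         ∃[ x′ ] (SubSum L x′ × x ≡ c ⊞ x′)
  subtract {c} {L} {x} z ¬two s x≢0 with y , sy , x+y≡Σ ← subSum-complement L s
    with subSum? L (c ⊞ y)
  ... | no c+y∉ = contradiction (c ⊞ y , c+y≢ , inj₂ (y , sy , refl) , c+y∉) ¬two
    where
    c+y≢ : c ⊞ y ≢ c ⊞ Σₗ L
    c+y≢ eq = x≢0 (absorb (trans x+y≡Σ (sym (∙-cancelˡ c y (Σₗ L) eq))))
  ... | yes c+y∈ with x′ , sx′ , eq ← subSum-complement L c+y∈ =
    x′ , sx′ , ∙-cancelʳ y x (c ⊞ x′) (trans x+y≡Σ (trans (sym eq)
      (solve 3 (λ c y x → (c ⊕ y) ⊕ x ⊜ (c ⊕ x) ⊕ y) refl c y x′)))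

  -- Otherwise both c ∷ L and d ∷ L have the same subset sums X, those of
  -- c ∷ d ∷ L other than the total sum.  Subtracting c from any nonzero element
  -- of X, or d, stays in X; so X contains c, hence c − d, hence − d.
  twoNew : ∀ {c d L} → c ≢ d → ZeroSumFree (c ∷ d ∷ L) → TwoNew c (d ∷ L) ⊎ TwoNew d (c ∷ L)
  twoNew {c} {d} {L} c≢d z with twoNew? c (d ∷ L) | twoNew? d (c ∷ L)
  ... | yes t | _     = inj₁ t
  ... | no _  | yes t = inj₂ t
  ... | no ¬c | no ¬d = contradiction d+x″≡0 (proj₂ z′ x″ x″∈′)
    where
    z′ : ZeroSumFree (d ∷ c ∷ L)
    z′ = zeroSumFree-↭ (swap c d refl) z

    Σ-comm : c ⊞ (d ⊞ Σₗ L) ≡ d ⊞ (c ⊞ Σₗ L)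
    Σ-comm = solve 3 (λ x y g → x ⊕ (y ⊕ g) ⊜ y ⊕ (x ⊕ g)) refl c d (Σₗ L)

    ⊆ᶜ : ∀ {x} → SubSum (c ∷ L) x → SubSum (d ∷ L) x
    ⊆ᶜ {x} s = decidable-stable (subSum? (d ∷ L) x) λ ∉ → ¬c (x ,
      (λ { refl → Σ-new {d} {c ∷ L} z′ (subst (SubSum (c ∷ L)) Σ-comm s) }) ,
      subSum-↭ (swap d c refl) (inj₁ s) , ∉)

    ⊆ᵈ : ∀ {x} → SubSum (d ∷ L) x → SubSum (c ∷ L) x
    ⊆ᵈ {x} s = decidable-stable (subSum? (c ∷ L) x) λ ∉ → ¬d (x ,
      (λ { refl → Σ-new {c} {d ∷ L} z (subst (SubSum (d ∷ L)) (sym Σ-comm) s) }) ,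
      subSum-↭ (swap c d refl) (inj₁ s) , ∉)

    c-d : ∃[ x ] (SubSum (c ∷ L) x × c ≡ d ⊞ x)
    c-d = subtract {d} {c ∷ L} z′ ¬d (subSum-∈ (here refl)) (head≢0 {c} {d ∷ L} z)

    x′ = proj₁ c-d

    x′≢0 : x′ ≢ 0#
    x′≢0 eq = c≢d (trans (proj₂ (proj₂ c-d)) (trans (cong (d ⊞_) eq) (identityʳ d)))

    -d : ∃[ x ] (SubSum (d ∷ L) x × x′ ≡ c ⊞ x)
    -d = subtract {c} {d ∷ L} z ¬c (⊆ᶜ (proj₁ (proj₂ c-d))) x′≢0

    x″ = proj₁ -d

    x″∈′ : SubSum (c ∷ L) x″
    x″∈′ = ⊆ᵈ (proj₁ (proj₂ -d))

    d+x″≡0 : d ⊞ x″ ≡ 0#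
    d+x″≡0 = absorb (trans (solve 3 (λ d x c → (d ⊕ x) ⊕ c ⊜ d ⊕ (c ⊕ x)) refl d x″ c)
      (sym (trans (proj₂ (proj₂ c-d)) (cong (d ⊞_) (proj₂ (proj₂ -d))))))

  -- It is not known which of `c` and `d` contributes two sums, hence the bound is assumed for both
  -- lists that omit one of them.
  grow-either : ∀ {c d L k} → c ≢ d → ZeroSumFree (c ∷ d ∷ L) → AtLeast k (d ∷ L) → AtLeast k (c ∷ L) →
                AtLeast (2 + k) (c ∷ d ∷ L)
  grow-either {c} {d} {L} c≢d z aᵈ aᶜ with twoNew c≢d z
  ... | inj₁ t = grow² z t aᵈ
  ... | inj₂ t = atLeast-↭ (swap d c refl) (grow² {d} {c ∷ L} (zeroSumFree-↭ (swap c d refl) z) t aᶜ)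

  -- Zero-sum free sets of two and three elements.

  atLeast-[] : AtLeast 1 []
  atLeast-[] = (0# ∷ []) , [] ∷ [] , refl ∷ [] , refl

  atLeast-four : ∀ {b c} → b ≢ c → ZeroSumFree (b ∷ c ∷ []) → AtLeast 4 (b ∷ c ∷ [])
  atLeast-four {b} {c} b≢c z = grow² {b} {c ∷ []} z
    -- Besides the total, `b` itself is new, as the tail has only the sums `0#` and `c`.
    (b , (λ eq → head≢0 {c} {[]} (proj₁ z) (∙-cancelˡ b c 0#
            (trans (cong (b ⊞_) (sym (identityʳ c))) (trans (sym eq) (sym (identityʳ b)))))) ,
      subSum-∈ (here refl) ,
      λ { (inj₁ b≡0) → head≢0 {b} {c ∷ []} z b≡0
        ; (inj₂ (_ , refl , b≡c+0)) → b≢c (trans b≡c+0 (identityʳ c)) })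
    (grow (proj₁ z) atLeast-[])

  -- The four sums of `b` and `c` are joined by `a ⊞ b`, `a ⊞ c` and the total. The element `a`
  -- itself is not counted, since it may equal `b ⊞ c`.
  atLeast-seven : ∀ {a b c} → a ≢ b → a ≢ c → b ≢ c → ZeroSumFree (a ∷ b ∷ c ∷ []) →
          b ≢ a ⊞ c → c ≢ a ⊞ b → AtLeast 7 (a ∷ b ∷ c ∷ [])
  atLeast-seven {a} {b} {c} a≢b a≢c b≢c z b≢a+c c≢a+b =
    grow-by (a ⊞ b ∷ a ⊞ c ∷ a ⊞ (b ⊞ (c ⊞ 0#)) ∷ [])
      ((a+b≢a+c ∷ a+b≢Σ ∷ []) ∷ (a+c≢Σ ∷ []) ∷ [] ∷ [])
      ( (inj₂ (b , subSum-∈ (here refl) , refl) , a+b∉)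
      ∷ (inj₂ (c , subSum-∈ (there (here refl)) , refl) , a+c∉)
      ∷ (subSum-Σ (a ∷ b ∷ c ∷ []) , Σ-new {a} {b ∷ c ∷ []} z) ∷ [])
      (atLeast-four b≢c (proj₁ z))
    where
    a≢0 = head≢0 {a} {b ∷ c ∷ []} z
    b≢0 = head≢0 {b} {c ∷ []} (proj₁ z)
    c≢0 = head≢0 {c} {[]} (proj₁ (proj₁ z))

    a+b≢a+c : a ⊞ b ≢ a ⊞ c
    a+b≢a+c eq = b≢c (∙-cancelˡ a b c eq)

    a+b≢Σ : a ⊞ b ≢ a ⊞ (b ⊞ (c ⊞ 0#))
    a+b≢Σ eq = c≢0 (absorb (trans (solve 2 (λ b c → c ⊕ b ⊜ b ⊕ (c ⊕ ⓪)) refl b c)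
      (sym (∙-cancelˡ a _ _ eq))))

    a+c≢Σ : a ⊞ c ≢ a ⊞ (b ⊞ (c ⊞ 0#))
    a+c≢Σ eq = b≢0 (absorb (trans (cong (b ⊞_) (sym (identityʳ c))) (sym (∙-cancelˡ a _ _ eq))))

    a+b∉ : ¬ SubSum (b ∷ c ∷ []) (a ⊞ b)
    a+b∉ (inj₁ (inj₁ eq)) = proj₂ z b (subSum-∈ (here refl)) eq
    a+b∉ (inj₁ (inj₂ (_ , refl , eq))) = c≢a+b (sym (trans eq (identityʳ c)))
    a+b∉ (inj₂ (_ , inj₁ refl , eq)) = a≢0 (absorb (trans eq (identityʳ b)))
    a+b∉ (inj₂ (_ , inj₂ (_ , refl , refl) , eq)) = a≢c (∙-cancelʳ b a c
      (trans eq (solve 2 (λ b c → b ⊕ (c ⊕ ⓪) ⊜ c ⊕ b) refl b c)))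

    a+c∉ : ¬ SubSum (b ∷ c ∷ []) (a ⊞ c)
    a+c∉ (inj₁ (inj₁ eq)) = proj₂ z c (subSum-∈ (there (here refl))) eq
    a+c∉ (inj₁ (inj₂ (_ , refl , eq))) = a≢0 (absorb (trans eq (identityʳ c)))
    a+c∉ (inj₂ (_ , inj₁ refl , eq)) = b≢a+c (sym (trans eq (identityʳ b)))
    a+c∉ (inj₂ (_ , inj₂ (_ , refl , refl) , eq)) = a≢b (∙-cancelʳ c a b
      (trans eq (cong (b ⊞_) (identityʳ c))))

  -- Involutions, and the bound 2k + 1 for sets of k ≥ 4 elements.

  Involution : Fin m → Set
  Involution h = h ⊞ h ≡ 0#

  Involution-free : List (Fin m) → Set
  Involution-free = All (¬_ ∘ Involution)

  involutive : ∀ {h} → Involution h → ∀ g → h ⊞ (h ⊞ g) ≡ g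
  involutive {h} 2h g = trans (sym (assoc h h g)) (trans (cong (_⊞ g) 2h) (identityˡ g))

  involution? : ∀ V → Involution-free V ⊎ ∃₂ λ h V₀ → V ↭ h ∷ V₀ × Involution h
  involution? [] = inj₁ []
  involution? (v ∷ V) with v ⊞ v ≟ 0# | involution? V
  ... | yes eq | _ = inj₂ (v , V , refl , eq)
  ... | no neq | inj₁ all = inj₁ (neq ∷ all)
  ... | no neq | inj₂ (h , V₀ , p , eq) = inj₂ (h , v ∷ V₀ , ↭-trans (prep v p) (swap v h refl) , eq)

  two-equations : ∀ {a b c} → a ≡ b ⊞ c → b ≡ a ⊞ c → Involution c
  two-equations {a} {b} {c} p q = absorb (trans
    (solve 2 (λ b c → (c ⊕ c) ⊕ b ⊜ (b ⊕ c) ⊕ c) refl b c) (sym (trans q (cong (_⊞ c) p))))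

  -- By `two-equations` at most one of the three elements is the sum of the other two; such an
  -- element is moved to the front, where `atLeast-seven` allows it.
  atLeast-seven-free : ∀ {a b c} → Unique (a ∷ b ∷ c ∷ []) → ZeroSumFree (a ∷ b ∷ c ∷ []) →
                       Involution-free (a ∷ b ∷ c ∷ []) → AtLeast 7 (a ∷ b ∷ c ∷ [])
  atLeast-seven-free {a} {b} {c} ((a≢b ∷ a≢c ∷ []) ∷ (b≢c ∷ []) ∷ [] ∷ []) z (2a ∷ 2b ∷ 2c ∷ [])
    with a ≟ b ⊞ c | b ≟ a ⊞ c | c ≟ a ⊞ b
  ... | _ | no q | no r = atLeast-seven a≢b a≢c b≢c z q r
  ... | yes p | yes q | _ = contradiction (two-equations p q) 2c
  ... | yes p | _ | yes r = contradiction (two-equations (trans p (comm b c)) r) 2b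
  ... | no p | yes q | yes r = contradiction (two-equations (trans q (comm a c)) (trans r (comm a b))) 2a
  ... | no p | yes q | no r = atLeast-↭ (swap b a refl)
    (atLeast-seven (≢-sym a≢b) b≢c a≢c (zeroSumFree-↭ (swap a b refl) z) p
      (λ eq → r (trans eq (comm b a))))
  ... | no p | no q | yes r = atLeast-↭ (↭-sym ρ)
    (atLeast-seven (≢-sym a≢c) (≢-sym b≢c) a≢b (zeroSumFree-↭ ρ z)
      (λ eq → p (trans eq (comm c b))) (λ eq → q (trans eq (comm c a))))
    where
    ρ : a ∷ b ∷ c ∷ [] ↭ c ∷ a ∷ b ∷ []
    ρ = shift c (a ∷ b ∷ []) []

  -- Adding `h` turns `r ≡ h ⊞ q` into `q ≡ h ⊞ r`, so excluding the latter meets both conditions of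
  -- `atLeast-seven`.
  atLeast-seven-involution : ∀ {h q r} → Unique (h ∷ q ∷ r ∷ []) → ZeroSumFree (h ∷ q ∷ r ∷ []) → Involution h →
                             q ≢ h ⊞ r → AtLeast 7 (h ∷ q ∷ r ∷ [])
  atLeast-seven-involution {h} {q} {r} ((h≢q ∷ h≢r ∷ []) ∷ (q≢r ∷ []) ∷ [] ∷ []) z 2h q≢h+r =
    atLeast-seven h≢q h≢r q≢r z q≢h+r λ r≡h+q → q≢h+r (sym (trans (cong (h ⊞_) r≡h+q) (involutive 2h q)))

  Periodic : Fin m → List (Fin m) → Set
  Periodic h L = ∀ {g} → SubSum L g → SubSum L (h ⊞ g)

  -- Adding `h` switches between the sums that use the head and those that do not.
  periodic-head : ∀ {h L} → Involution h → Periodic h (h ∷ L)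
  periodic-head 2h (inj₁ s) = inj₂ (_ , s , refl)
  periodic-head {h} {L} 2h (inj₂ (g , s , refl)) = inj₁ (subst (SubSum L) (sym (involutive 2h g)) s)

  periodic-∷ : ∀ {h c L} → Periodic h L → Periodic h (c ∷ L)
  periodic-∷ p (inj₁ s) = inj₁ (p s)
  periodic-∷ {h} {c} p (inj₂ (g , s , refl)) =
    inj₂ (h ⊞ g , p s , solve 3 (λ h c g → h ⊕ (c ⊕ g) ⊜ c ⊕ (h ⊕ g)) refl h c g)

  -- Along with the total `t`, its translate `h ⊞ t` is new: were it an old sum, so would be `t` by
  -- periodicity.
  grow-periodic : ∀ {h c L k} → h ≢ 0# → Involution h → Periodic h L → ZeroSumFree (c ∷ L) →
                  AtLeast k L → AtLeast (2 + k) (c ∷ L)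
  grow-periodic {h} {c} {L} h≢0 2h p z = grow² z
    ( h ⊞ t , (λ eq → h≢0 (absorb eq)) , periodic-∷ p (subSum-Σ (c ∷ L))
    , λ s → Σ-new {c} {L} z (subst (SubSum L) (involutive 2h t) (p s)))
    where
    t = c ⊞ Σₗ L

  grow-periodic-++ : ∀ {h} W {V k} → h ≢ 0# → Involution h → Periodic h V → ZeroSumFree (W ++ V) →
                     AtLeast k V → AtLeast (length W + length W + k) (W ++ V)
  grow-periodic-++ W {V} {k} h≢0 2h p z a = go W z
    where
    periodic-++ : ∀ W → Periodic _ (W ++ V)
    periodic-++ []      = p
    periodic-++ (w ∷ W) = periodic-∷ (periodic-++ W)

    go : ∀ W → ZeroSumFree (W ++ V) → AtLeast (length W + length W + k) (W ++ V)
    go []      z = a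
    go (w ∷ W) z = subst (λ n → AtLeast (suc (n + k)) (w ∷ W ++ V)) (sym (+-suc (length W) (length W)))
      (grow-periodic h≢0 2h (periodic-++ W) z (go W (proj₁ z)))

  -- Since `p` and `q` differ, they are not both `h ⊞ r`. One of them forms with `h` and `r` a
  -- triple with seven sums, and the other adds two by periodicity.
  atLeast-nine-involution : ∀ {h p q r} → Unique (h ∷ p ∷ q ∷ r ∷ []) → ZeroSumFree (h ∷ p ∷ q ∷ r ∷ []) →
                            Involution h → AtLeast 9 (h ∷ p ∷ q ∷ r ∷ [])
  atLeast-nine-involution {h} {p} {q} {r} ((h≢p ∷ h≢q ∷ h≢r ∷ []) ∷ (p≢q ∷ p≢r ∷ []) ∷ (q≢r ∷ []) ∷ [] ∷ []) z 2h
    with q ≟ h ⊞ r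
  ... | no q≢h+r = atLeast-↭ (swap p h refl)
      (grow-periodic (head≢0 {h} {p ∷ q ∷ r ∷ []} z) 2h (periodic-head 2h) z′
        (atLeast-seven-involution ((h≢q ∷ h≢r ∷ []) ∷ (q≢r ∷ []) ∷ [] ∷ []) (proj₁ z′) 2h q≢h+r))
    where z′ = zeroSumFree-↭ (swap h p refl) z
  ... | yes refl = atLeast-↭ (↭-sym ρ)
      (grow-periodic (head≢0 {h} {p ∷ q ∷ r ∷ []} z) 2h (periodic-head 2h) z′
        (atLeast-seven-involution ((h≢p ∷ h≢r ∷ []) ∷ (p≢r ∷ []) ∷ [] ∷ []) (proj₁ z′) 2h p≢q))
    where
    ρ : h ∷ p ∷ q ∷ r ∷ [] ↭ q ∷ h ∷ p ∷ r ∷ []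
    ρ = shift q (h ∷ p ∷ []) (r ∷ [])
    z′ = zeroSumFree-↭ ρ z

  atLeast-nine : ∀ {V} → length V ≡ 4 → Unique V → ZeroSumFree V → AtLeast 9 V
  atLeast-nine {V} len u z with involution? V
  atLeast-nine {_ ∷ _ ∷ _ ∷ _ ∷ []} _ ((a≢b ∷ a≢) ∷ b≢ ∷ u) z | inj₁ (2a ∷ 2b ∷ 2V) =
    grow-either a≢b z
      (atLeast-seven-free (b≢ ∷ u) (proj₁ z) (2b ∷ 2V))
      (atLeast-seven-free (a≢ ∷ u) (proj₁ (zeroSumFree-↭ (swap _ _ refl) z)) (2a ∷ 2V))
  atLeast-nine len u z | inj₂ (h , V₀ , p , 2h) with trans (sym (↭-length p)) len
  atLeast-nine len u z | inj₂ (h , _ ∷ _ ∷ _ ∷ [] , p , 2h) | refl =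
    atLeast-↭ (↭-sym p) (atLeast-nine-involution (Unique-↭ p u) (zeroSumFree-↭ p z) 2h)

  -- Here `k = 4 + n`, and each step adds two sums. The induction cannot start at three elements:
  -- `{h, r, h + r}` with `h + h = 0` has at most six sums.
  atLeast-2k+1 : ∀ n {V} → length V ≡ 4 + n → Unique V → ZeroSumFree V → AtLeast (9 + (n + n)) V
  atLeast-2k+1 zero    = atLeast-nine
  atLeast-2k+1 (suc n) {c ∷ d ∷ V} len ((c≢d ∷ c≢) ∷ d≢ ∷ u) z =
    subst (λ k → AtLeast (10 + k) (c ∷ d ∷ V)) (sym (+-suc n n)) (grow-either c≢d z
      (atLeast-2k+1 n (suc-injective len) (d≢ ∷ u) (proj₁ z))
      (atLeast-2k+1 n (suc-injective len) (c≢ ∷ u) (proj₁ (zeroSumFree-↭ (swap c d refl) z))))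

  -- There are four sums for `a` and `b`, at least five after either repetition, and two more once
  -- both are repeated.
  atLeast-seven-pairs : ∀ {a b} → a ≢ b → ZeroSumFree (a ∷ b ∷ a ∷ b ∷ []) → AtLeast 7 (a ∷ b ∷ a ∷ b ∷ [])
  atLeast-seven-pairs {a} {b} a≢b z = grow-either a≢b z
    (grow (proj₁ z) (atLeast-four a≢b (proj₁ (proj₁ z))))
    (grow (proj₁ (zeroSumFree-↭ (swap a b refl) z)) (atLeast-four a≢b (proj₁ (proj₁ z))))

  -- 0, the elements and the negatives of those other than c are all distinct.
  squarefree-bound : ∀ {c V} → Unique (c ∷ V) → ZeroSumFree V → c ⊞ Σₗ V ≡ 0# → Involution-free V →
                     2 ≤ length V → (2 + length V) + length V ≤ m
  squarefree-bound {c} {V} (c∉V ∷ uV) z c+Σ free 2≤ =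
    subst (_≤ m) (trans (length-++ (0# ∷ c ∷ V)) (cong (2 + length V +_) (length-map -_ V)))
      (Unique⇒length≤ (Uniqueₚ.++⁺ ((0≢c ∷ All.tabulate 0≢V) ∷ c∉V ∷ uV)
        (Uniqueₚ.map⁺ ⁻¹-injective uV) disjoint))
    where
    0≢V : ∀ {v} → v ∈ₗ V → 0# ≢ v
    0≢V v∈V 0≡v = ∈⇒≢0 z v∈V (sym 0≡v)

    nonempty : ∀ {V} → 1 ≤ length V → ZeroSumFree V → Σₗ V ≢ 0#
    nonempty {v ∷ V} _ z = Σ≢0 {v} {V} z

    0≢c : 0# ≢ c
    0≢c 0≡c = nonempty (≤-trans (s≤s z≤n) 2≤) z (trans (sym (identityˡ _)) (trans (cong (_⊞ Σₗ V) 0≡c) c+Σ))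

    Σ-↭ : ∀ {L K} → L ↭ K → Σₗ L ≡ Σₗ K
    Σ-↭ refl = refl
    Σ-↭ (prep x p) = cong (x ⊞_) (Σ-↭ p)
    Σ-↭ (swap {xs = L} x y p) = trans (solve 3 (λ x y g → x ⊕ (y ⊕ g) ⊜ y ⊕ (x ⊕ g)) refl x y (Σₗ L))
      (cong (λ g → y ⊞ (x ⊞ g)) (Σ-↭ p))
    Σ-↭ (↭-compose p q) = trans (Σ-↭ p) (Σ-↭ q)

    -- Otherwise the elements of `V` other than `v`, of which there is at least one, would have sum
    -- zero.
    c+v≢0 : ∀ {v} → v ∈ₗ V → c ⊞ v ≢ 0#
    c+v≢0 {v} v∈V eq with V₁ , p ← ∈⇒↭ v∈V =
      nonempty (ℕ.s≤s⁻¹ (subst (2 ≤_) (↭-length p) 2≤)) (proj₁ (zeroSumFree-↭ p z)) (begin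
        Σₗ V₁               ≡⟨ identityˡ _ ⟨
        0# ⊞ Σₗ V₁          ≡⟨ cong (_⊞ Σₗ V₁) eq ⟨
        (c ⊞ v) ⊞ Σₗ V₁     ≡⟨ assoc c v _ ⟩
        c ⊞ (v ⊞ Σₗ V₁)     ≡⟨ cong (c ⊞_) (Σ-↭ p) ⟨
        c ⊞ Σₗ V            ≡⟨ c+Σ ⟩
        0#                  ∎)
      where open ≡-Reasoning

    disjoint : ∀ {x} → x ∈ₗ 0# ∷ c ∷ V × x ∈ₗ map -_ V → _
    disjoint (x∈ , x∈-) with v , v∈V , refl ← ∈-map⁻ -_ x∈- with x∈
    ... | here -v≡0 = ∈⇒≢0 z v∈V (trans (sym (identityʳ v)) (trans (cong (v ⊞_) (sym -v≡0)) (inverseʳ v)))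
    ... | there (here -v≡c) = c+v≢0 v∈V (trans (cong (_⊞ v) (sym -v≡c)) (inverseˡ v))
    -- Either `v` equals its negative and is an involution, or the two are distinct elements of `V`
    -- with sum zero.
    ... | there (there -v∈V) with v ≟ - v
    ...   | yes v≡-v = All.lookup free v∈V (trans (cong (v ⊞_) v≡-v) (inverseʳ v))
    ...   | no v≢-v = pair≢0 z v∈V -v∈V v≢-v (inverseʳ v)

-- Multisets given by lists.

module _ {m : ℕ} where

  ⟦_⟧ : List (Fin m) → Multiset m
  ⟦ L ⟧ a = length (filter (a ≟_) L)

  ⟦⟧-here : ∀ a L → ⟦ a ∷ L ⟧ a ≡ suc (⟦ L ⟧ a)
  ⟦⟧-here a L = cong length (filter-accept (a ≟_) refl)

  ⟦⟧-there : ∀ {a c} L → a ≢ c → ⟦ c ∷ L ⟧ a ≡ ⟦ L ⟧ a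
  ⟦⟧-there {a} L a≢c = cong length (filter-reject (a ≟_) a≢c)

  ⟦⟧-++ : ∀ K L a → ⟦ K ++ L ⟧ a ≡ ⟦ K ⟧ a + ⟦ L ⟧ a
  ⟦⟧-++ K L a = trans (cong length (filter-++ (a ≟_) K L)) (length-++ (filter (a ≟_) K))

  ⟦⟧-↭ : ∀ {K L} → K ↭ L → ⟦ K ⟧ ≗ ⟦ L ⟧
  ⟦⟧-↭ p a = ↭-length (filter-↭ (a ≟_) p)

  ⟦⟧-all : ∀ {a L} → All (a ≡_) L → ⟦ L ⟧ a ≡ length L
  ⟦⟧-all {a} eqs = cong length (filter-all (a ≟_) eqs)

  ⟦⟧-none : ∀ {a L} → All (a ≢_) L → ⟦ L ⟧ a ≡ 0
  ⟦⟧-none {a} neqs = cong length (filter-none (a ≟_) neqs)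

  ∈⇒1≤ : ∀ {a L} → a ∈ₗ L → 1 ≤ ⟦ L ⟧ a
  ∈⇒1≤ {a} {L = _ ∷ L} (here refl) = subst (1 ≤_) (sym (⟦⟧-here a L)) (s≤s z≤n)
  ∈⇒1≤ {a} {L = c ∷ L} (there a∈L) with a ≟ c
  ... | yes refl = s≤s z≤n
  ... | no  _    = ∈⇒1≤ a∈L

  1≤⇒∈ : ∀ {a} L → 1 ≤ ⟦ L ⟧ a → a ∈ₗ L
  1≤⇒∈ {a} (c ∷ L) 1≤ with a ≟ c
  ... | yes refl = here refl
  ... | no  _    = there (1≤⇒∈ L 1≤)

  ⟦⟧-∷ : ∀ c L a → ⟦ L ⟧ a ≤ ⟦ c ∷ L ⟧ a
  ⟦⟧-∷ c L a with a ≟ c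
  ... | yes _ = n≤1+n _
  ... | no  _ = ≤-refl

  ∷-mono : ∀ {K L} c → ⟦ K ⟧ ⊆ ⟦ L ⟧ → ⟦ c ∷ K ⟧ ⊆ ⟦ c ∷ L ⟧
  ∷-mono c K⊆L a with a ≟ c
  ... | yes _ = s≤s (K⊆L a)
  ... | no  _ = K⊆L a

  ≤1⇒Unique : ∀ {L} → (∀ a → ⟦ L ⟧ a ≤ 1) → Unique L
  ≤1⇒Unique {[]}    _   = []
  ≤1⇒Unique {c ∷ L} ≤1 =
    ¬Any⇒All¬ L (λ c∈L → <⇒≱ (∈⇒1≤ c∈L) (ℕ.s≤s⁻¹ (subst (_≤ 1) (⟦⟧-here c L) (≤1 c)))) ∷
    ≤1⇒Unique (λ a → ≤-trans (⟦⟧-∷ c L a) (≤1 a))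

-- Splitting a multiset into its support and the excess copies.

-- The map `f` is arbitrary so that the recursion can pass to `f ∘ suc`; `decompose` takes `f = id`.
copies : ∀ {n m} → (Fin n → Fin m) → Multiset n → List (Fin m)
copies {zero}  f T = []
copies {suc n} f T = replicate (T 0F) (f 0F) ++ copies (f ∘ suc) (T ∘ suc)

length-copies : ∀ {n m} (f : Fin n → Fin m) T → length (copies f T) ≡ (# T)
length-copies {zero}  f T = refl
length-copies {suc n} f T = trans (length-++ (replicate (T 0F) (f 0F)))
  (cong₂ _+_ (length-replicate (T 0F)) (length-copies (f ∘ suc) (T ∘ suc)))

copies-∉ : ∀ {n m} (f : Fin n → Fin m) T {a} → (∀ i → a ≢ f i) → ⟦ copies f T ⟧ a ≡ 0
copies-∉ {zero}  f T a∉ = refl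
copies-∉ {suc n} f T a∉ = trans (⟦⟧-++ (replicate (T 0F) (f 0F)) _ _)
  (cong₂ _+_ (⟦⟧-none (All-replicate⁺ (T 0F) (a∉ 0F))) (copies-∉ (f ∘ suc) (T ∘ suc) (a∉ ∘ suc)))

⟦copies⟧ : ∀ {n m} (f : Fin n → Fin m) T → (∀ {i j} → f i ≡ f j → i ≡ j) → ∀ i → ⟦ copies f T ⟧ (f i) ≡ T i
⟦copies⟧ f T inj 0F = begin
  ⟦ copies f T ⟧ (f 0F)
    ≡⟨ ⟦⟧-++ (replicate (T 0F) (f 0F)) _ (f 0F) ⟩
  ⟦ replicate (T 0F) (f 0F) ⟧ (f 0F) + ⟦ copies (f ∘ suc) (T ∘ suc) ⟧ (f 0F)
    ≡⟨ cong₂ _+_ (trans (⟦⟧-all (All-replicate⁺ (T 0F) refl)) (length-replicate (T 0F)))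
                 (copies-∉ (f ∘ suc) (T ∘ suc) (λ i eq → contradiction (inj eq) λ ())) ⟩
  T 0F + 0
    ≡⟨ +-identityʳ (T 0F) ⟩
  T 0F ∎
  where open ≡-Reasoning
⟦copies⟧ f T inj (suc i) = begin
  ⟦ copies f T ⟧ (f (suc i))
    ≡⟨ ⟦⟧-++ (replicate (T 0F) (f 0F)) _ (f (suc i)) ⟩
  ⟦ replicate (T 0F) (f 0F) ⟧ (f (suc i)) + ⟦ copies (f ∘ suc) (T ∘ suc) ⟧ (f (suc i))
    ≡⟨ cong₂ _+_ (⟦⟧-none (All-replicate⁺ (T 0F) (λ eq → contradiction (inj eq) λ ())))
                 (⟦copies⟧ (f ∘ suc) (T ∘ suc) (Fin-suc-injective ∘ inj) i) ⟩
  T (suc i) ∎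
  where open ≡-Reasoning

-- Truncating multiplicities at 1 gives the indicator function of the support.
σ≡#⊓1 : ∀ {n} (S : Multiset n) → σ S ≡ (# (λ a → S a ⊓ 1))
σ≡#⊓1 {zero}  S = refl
σ≡#⊓1 {suc n} S with S 0F
... | zero  = σ≡#⊓1 (S ∘ suc)
... | suc k rewrite ⊓-zeroʳ k = cong suc (σ≡#⊓1 (S ∘ suc))

pred+⊓1 : ∀ n → pred n + n ⊓ 1 ≡ n
pred+⊓1 zero    = refl
pred+⊓1 (suc n) rewrite ⊓-zeroʳ n = +-comm n 1

-- `support` holds one copy of each element of `S`, and `excess` the remaining `S a ∸ 1` copies.
record Decomposition {m} (S : Multiset m) : Set where
  field
    excess support : List (Fin m)
    unique         : Unique support
    multiplicity   : S ≗ ⟦ excess ++ support ⟧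
    size           : length excess + length support ≡ (# S)
    width          : length support ≡ σ S
    complete       : ∀ {a} → 1 ≤ S a → a ∈ₗ support

decompose : ∀ {m} (S : Multiset m) → Decomposition S
decompose S = record
  { excess       = copies id (pred ∘ S)
  ; support      = copies id S⊓1
  ; unique       = ≤1⇒Unique (λ a → subst (_≤ 1) (sym (⟦copies⟧ id S⊓1 id a)) (m⊓n≤n (S a) 1))
  ; multiplicity = λ a → sym (trans (⟦⟧-++ (copies id (pred ∘ S)) _ a)
      (trans (cong₂ _+_ (⟦copies⟧ id (pred ∘ S) id a) (⟦copies⟧ id S⊓1 id a)) (pred+⊓1 (S a))))
  ; size         = trans (cong₂ _+_ (length-copies id (pred ∘ S)) (length-copies id S⊓1))
      (trans (sym (∑-distrib-+ (pred ∘ S) S⊓1)) (sum-cong-≗ (pred+⊓1 ∘ S)))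
  ; width        = trans (length-copies id S⊓1) (sym (σ≡#⊓1 S))
  ; complete     = λ {a} 1≤ → 1≤⇒∈ (copies id S⊓1)
      (subst (1 ≤_) (sym (⟦copies⟧ id S⊓1 id a)) (⊓-glb 1≤ ≤-refl))
  }
  where
  open CommutativeMonoidSum +-0-commutativeMonoid using (∑-distrib-+; sum-cong-≗)
  S⊓1 = λ a → S a ⊓ 1

-- Minimal zero-sum multisets and involutions in ℤ/m.

module _ {m : ℕ} .{{_ : NonZero m}} where

  open AbelianGroup (ℤ/ m) using (ε; isAbelianGroup; commutativeMonoid; assoc; identityʳ; rawMonoid) renaming (_∙_ to _⊞_)
  open CommutativeMonoidSum commutativeMonoid using (sum; sum-remove; sum-cong-≗; sum-replicate-zero)
  open RawMonoidOperations rawMonoid using () renaming (_×_ to _·_)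
  open SubsetSums isAbelianGroup

  sum-change : ∀ {n} (s t : Vector (Fin m) n) i x → s i ≡ x ⊞ t i → (∀ j → j ≢ i → s j ≡ t j) → sum s ≡ x ⊞ sum t
  sum-change {suc n} s t i x eq neq = begin
    sum s
      ≡⟨ sum-remove {i = i} s ⟩
    s i ⊞ sum (λ j → s (punchIn i j))
      ≡⟨ cong₂ _⊞_ eq (sum-cong-≗ (λ j → neq _ (punchInᵢ≢i i j))) ⟩
    (x ⊞ t i) ⊞ sum (λ j → t (punchIn i j))
      ≡⟨ assoc x (t i) _ ⟩
    x ⊞ (t i ⊞ sum (λ j → t (punchIn i j)))
      ≡⟨ cong (x ⊞_) (sum-remove {i = i} t) ⟨
    x ⊞ sum t ∎
    where open ≡-Reasoning

  -- Prepending `c` raises only the multiplicity of `c`, so only the summand at `c` changes.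
  Σ⟦⟧ : ∀ L → Σ[ ⟦ L ⟧ ] ≡ Σₗ L
  Σ⟦⟧ []      = sum-replicate-zero m
  Σ⟦⟧ (c ∷ L) = trans
    (sum-change (λ a → ⟦ c ∷ L ⟧ a · a) (λ a → ⟦ L ⟧ a · a) c c
      (cong (_· c) (⟦⟧-here c L)) (λ a a≢c → cong (_· a) (⟦⟧-there L a≢c)))
    (cong (c ⊞_) (Σ⟦⟧ L))

  Σ-cong : ∀ {S T : Multiset m} → S ≗ T → Σ[ S ] ≡ Σ[ T ]
  Σ-cong S≗T = sum-cong-≗ (λ a → cong (_· a) (S≗T a))

  submultiset : ∀ L {g} → SubSum L g → ∃[ K ] (⟦ K ⟧ ⊆ ⟦ L ⟧ × Σₗ K ≡ g)
  submultiset []      refl = [] , (λ a → z≤n) , refl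
  submultiset (c ∷ L) (inj₁ s) with K , K⊆L , eq ← submultiset L s =
    K , (λ a → ≤-trans (K⊆L a) (⟦⟧-∷ c L a)) , eq
  submultiset (c ∷ L) (inj₂ (g , s , refl)) with K , K⊆L , eq ← submultiset L s =
    c ∷ K , ∷-mono c K⊆L , cong (c ⊞_) eq

  -- A nonempty subsequence of `L` with sum zero would be a zero-sum submultiset of `S`, proper
  -- because its multiplicity at `b` stays below `S b`.
  ⊂⇒zeroSumFree : ∀ {S} → MinimalZeroSum S → ∀ L → ⟦ L ⟧ ⊂ S → ZeroSumFree L
  ⊂⇒zeroSumFree min [] _ = _
  ⊂⇒zeroSumFree min@(_ , _ , irreducible) (c ∷ L) (L⊆S , b , Lb<Sb) =
    ⊂⇒zeroSumFree min L ((λ a → ≤-trans (⟦⟧-∷ c L a) (L⊆S a)) , b , ≤-<-trans (⟦⟧-∷ c L b) Lb<Sb) ,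
    λ g s c+g≡0 → let K , K⊆L , eq = submultiset L s in
      irreducible ⟦ c ∷ K ⟧
        ((λ a → ≤-trans (∷-mono c K⊆L a) (L⊆S a)) , b , ≤-<-trans (∷-mono c K⊆L b) Lb<Sb)
        (c , ∈⇒1≤ {L = c ∷ K} (here refl))
        (trans (Σ⟦⟧ (c ∷ K)) (trans (cong (c ⊞_) eq) c+g≡0))

  zeroSumFree-tail : ∀ {S} → MinimalZeroSum S → ∀ {x L} → S ≗ ⟦ x ∷ L ⟧ → ZeroSumFree L
  zeroSumFree-tail min {x} {L} S≗ = ⊂⇒zeroSumFree min L
    ( (λ a → subst (⟦ L ⟧ a ≤_) (sym (S≗ a)) (⟦⟧-∷ x L a))
    , x , subst (⟦ L ⟧ x <_) (sym (trans (S≗ x) (⟦⟧-here x L))) ≤-refl)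

  Σₗ≡0 : ∀ {S} → MinimalZeroSum S → ∀ L → S ≗ ⟦ L ⟧ → Σₗ L ≡ ε
  Σₗ≡0 (_ , zero-sum , _) L S≗ = trans (sym (Σ⟦⟧ L)) (trans (sym (Σ-cong S≗)) zero-sum)

  toℕ-ε : toℕ ε ≡ 0
  toℕ-ε = trans (toℕ-mod m 0) (m*n%n≡0 0 m)

  -- The double of `toℕ h` is a multiple of `m` strictly between 0 and `m + m`.
  toℕ-involution : ∀ {h} → h ≢ ε → Involution h → toℕ h + toℕ h ≡ m
  toℕ-involution {h} h≢0 2h with m%n≡0⇒n∣m (toℕ h + toℕ h) m (trans (sym (toℕ-mod m _)) (trans (cong toℕ 2h) toℕ-ε))
  ... | divides zero eq = contradiction (toℕ-injective (trans (m+n≡0⇒m≡0 (toℕ h) eq) (sym toℕ-ε))) h≢0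
  ... | divides (suc zero) eq = trans eq (+-identityʳ m)
  ... | divides (suc (suc k)) eq = contradiction (+-mono-< (toℕ<n h) (toℕ<n h))
    (≤⇒≯ (subst (m + m ≤_) (sym eq) (+-monoʳ-≤ m (m≤m+n m (k * m)))))

  double-injective : ∀ a b → a + a ≡ b + b → a ≡ b
  double-injective a b eq with <-cmp a b
  ... | tri< a<b _ _ = contradiction eq (<⇒≢ (+-mono-< a<b a<b))
  ... | tri≈ _ a≡b _ = a≡b
  ... | tri> _ _ b<a = contradiction (sym eq) (<⇒≢ (+-mono-< b<a b<a))

  involution-unique : ∀ {g h} → g ≢ ε → h ≢ ε → Involution g → Involution h → g ≡ h
  involution-unique g≢0 h≢0 2g 2h =
    toℕ-injective (double-injective _ _ (trans (toℕ-involution g≢0 2g) (sym (toℕ-involution h≢0 2h))))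

-- The exceptional multisets modulo 6.

Exception : ∀ m .{{_ : NonZero m}} → Multiset m → Set
Exception m S = S ≗ ⟅ 1 ∷ 3 ∷ 4 ∷ 4 ∷ [] ⟆ ⊎ S ≗ ⟅ 2 ∷ 2 ∷ 3 ∷ 5 ∷ [] ⟆

module _ where
  open AbelianGroup (ℤ/ 6) using (ε) renaming (_∙_ to _⊞_)

  -- Decided by running through all `h`, `r` and `x` in ℤ/6. The equation for `x` is the zero-sum
  -- condition on the four elements.
  exception₆ : ∀ h r x → h ≢ ε → h ⊞ h ≡ ε → r ≢ ε → h ≢ r → x ⊞ ((h ⊞ r) ⊞ (h ⊞ (r ⊞ ε))) ≡ ε →
               Exception 6 ⟦ x ∷ h ⊞ r ∷ h ∷ r ∷ [] ⟧
  exception₆ = from-yes (all? λ h → all? λ r → all? λ x →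
    ¬? (h ≟ ε) →-dec ((h ⊞ h ≟ ε) →-dec (¬? (r ≟ ε) →-dec (¬? (h ≟ r) →-dec
    ((x ⊞ ((h ⊞ r) ⊞ (h ⊞ (r ⊞ ε))) ≟ ε) →-dec
    (all? (λ a → ⟦ x ∷ h ⊞ r ∷ h ∷ r ∷ [] ⟧ a ℕₚ.≟ ⟅ 1 ∷ 3 ∷ 4 ∷ 4 ∷ [] ⟆ a) ⊎-dec
     all? (λ a → ⟦ x ∷ h ⊞ r ∷ h ∷ r ∷ [] ⟧ a ℕₚ.≟ ⟅ 2 ∷ 2 ∷ 3 ∷ 5 ∷ [] ⟆ a)))))))

exception : ∀ m .{{_ : NonZero m}} → let open AbelianGroup (ℤ/ m) renaming (_∙_ to _⊞_) in m ≡ 6 →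
            ∀ {h r x} → h ≢ ε → h ⊞ h ≡ ε → r ≢ ε → h ≢ r → x ⊞ ((h ⊞ r) ⊞ (h ⊞ (r ⊞ ε))) ≡ ε →
            Exception m ⟦ x ∷ h ⊞ r ∷ h ∷ r ∷ [] ⟧
exception .6 refl {h} {r} {x} = exception₆ h r x

-- The bound for supports of at least three elements.

module _ {m : ℕ} .{{_ : NonZero m}} where

  open AbelianGroup (ℤ/ m) using (ε; isAbelianGroup; assoc; identityʳ) renaming (_∙_ to _⊞_)
  open SubsetSums isAbelianGroup

  -- The element singled out in `squarefree-bound` is the involution if there is one, as the others
  -- must not be involutions.
  squarefree : ∀ {S : Multiset m} → MinimalZeroSum S → ∀ V → S ≗ ⟦ V ⟧ → Unique V → 3 ≤ length V →
               length V + length V ≤ m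
  squarefree min V S≗ u 3≤ with involution? V
  squarefree min (c ∷ V) S≗ u (s≤s 2≤) | inj₁ (_ ∷ free) =
    subst (_≤ m) (cong suc (sym (+-suc (length V) (length V))))
      (squarefree-bound u (zeroSumFree-tail min S≗) (Σₗ≡0 min (c ∷ V) S≗) free 2≤)
  squarefree {S} min V S≗ u 3≤ | inj₂ (h , V₀ , p , 2h) =
    subst (_≤ m) (trans (cong suc (sym (+-suc (length V₀) (length V₀)))) (cong (λ n → n + n) (sym (↭-length p))))
      (squarefree-bound (Unique-↭ p u) z (Σₗ≡0 min (h ∷ V₀) S≗′) (All.tabulate free) 2≤)
    where
    2≤ : 2 ≤ length V₀
    2≤ = ℕ.s≤s⁻¹ (subst (3 ≤_) (↭-length p) 3≤)

    S≗′ : S ≗ ⟦ h ∷ V₀ ⟧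
    S≗′ a = trans (S≗ a) (⟦⟧-↭ p a)

    z = zeroSumFree-tail min S≗′

    -- A second involution would equal `h`. That `h` is nonzero follows by removing `v` instead,
    -- which leaves `h` in a zero-sum free list.
    free : ∀ {v} → v ∈ₗ V₀ → ¬ Involution v
    free {v} v∈V₀ 2v with Unique-↭ p u | ∈⇒↭ v∈V₀
    ... | h≢ ∷ _ | V₁ , q = All.lookup h≢ v∈V₀ (involution-unique h≢0 (∈⇒≢0 z v∈V₀) 2h 2v)
      where
      h≢0 : h ≢ ε
      h≢0 = head≢0 {h} {V₁} (zeroSumFree-tail min
        (λ a → trans (S≗′ a) (⟦⟧-↭ (↭-trans (prep h q) (swap h v refl)) a)))

  -- With `W` the excess and `V` the support, the inequality is #S + σ(S) ≤ m. If `W` is nonempty,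
  -- its head `x` is removed, which keeps `V` intact and leaves a zero-sum free list.
  bound-lists : ∀ {S : Multiset m} → MinimalZeroSum S → ∀ W V → S ≗ ⟦ W ++ V ⟧ → Unique V → 3 ≤ length V →
                (length W + length V) + length V ≤ m ⊎ (m ≡ 6 × Exception m S)
  bound-lists min [] V S≗ u 3≤ = inj₁ (squarefree min V S≗ u 3≤)
  bound-lists min (x ∷ W) (_ ∷ []) S≗ u (s≤s ())
  bound-lists min (x ∷ W) (_ ∷ _ ∷ []) S≗ u (s≤s (s≤s ()))
  bound-lists min (x ∷ W) V@(_ ∷ _ ∷ _ ∷ _ ∷ V′) S≗ u _ =
    -- The surplus 1 in 2k + 1 makes up for the removed `x`.
    inj₁ (subst (_≤ m) (arith (length W) (length V′))
      (atLeast⇒≤ (grow-++ W z (atLeast-2k+1 (length V′) refl u (zeroSumFree-drop W z)))))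
    where
    z = zeroSumFree-tail min S≗

    arith : ∀ w n → w + (9 + (n + n)) ≡ suc w + (4 + n) + (4 + n)
    arith = solve-∀
  bound-lists {S} min (x ∷ W) V@(_ ∷ _ ∷ _ ∷ []) S≗ u _ with involution? V
  ... | inj₁ free = inj₁ (subst (_≤ m) (arith (length W))
      (atLeast⇒≤ (grow-++ W z (atLeast-seven-free u (zeroSumFree-drop W z) free))))
    where
    z = zeroSumFree-tail min S≗

    arith : ∀ w → w + 7 ≡ suc w + 3 + 3
    arith = solve-∀
  ... | inj₂ (h , V₀ , p , 2h) with ↭-length p
  bound-lists {S} min (x ∷ W) V@(_ ∷ _ ∷ _ ∷ []) S≗ u _ | inj₂ (h , q ∷ r ∷ [] , p , 2h) | refl = main
    where
    σ₁ : V ↭ q ∷ h ∷ r ∷ []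
    σ₁ = ↭-trans p (swap h q refl)

    S≗′ : S ≗ ⟦ x ∷ W ++ q ∷ h ∷ r ∷ [] ⟧
    S≗′ a = trans (S≗ a) (⟦⟧-↭ (++⁺ˡ (x ∷ W) σ₁) a)

    zW : ZeroSumFree (W ++ q ∷ h ∷ r ∷ [])
    zW = zeroSumFree-tail min S≗′

    z : ZeroSumFree (q ∷ h ∷ r ∷ [])
    z = zeroSumFree-drop W zW

    u′ : Unique (h ∷ q ∷ r ∷ [])
    u′ = Unique-↭ p u

    h≢0 : h ≢ ε
    h≢0 = head≢0 {h} {r ∷ []} (proj₁ z)

    h≢r : h ≢ r
    h≢r with u′
    ... | (_ ∷ h≢r ∷ []) ∷ _ = h≢r

    six : AtLeast 6 (q ∷ h ∷ r ∷ [])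
    six = grow-periodic h≢0 2h (periodic-head 2h) z (atLeast-four h≢r (proj₁ z))

    arith₇ : ∀ w → w + 7 ≡ suc w + 3 + 3
    arith₇ = solve-∀

    -- Periodicity under `h` makes each element of `W` add two to the six sums of `q`, `h`, `r`,
    -- which suffices for nonempty `W`. For empty `W` only `6 ≤ m` is left, so the bound can fail
    -- only at `m ≡ 6`.
    exceptional : ∀ W → S ≗ ⟦ x ∷ W ++ q ∷ h ∷ r ∷ [] ⟧ → q ≡ h ⊞ r →
                  suc (length W) + 3 + 3 ≤ m ⊎ (m ≡ 6 × Exception m S)
    exceptional (w ∷ W) S≗ _ = inj₁ (m+n≤o⇒m≤o _ (subst (_≤ m) (sym (cong suc (arith₆ (length W))))
        (atLeast⇒≤ (grow-periodic-++ (w ∷ W) h≢0 2h (periodic-∷ (periodic-head 2h)) (zeroSumFree-tail min S≗) six))))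
      where
      arith₆ : ∀ w → (suc w + 3 + 3) + w ≡ w + suc w + 6
      arith₆ = solve-∀
    exceptional [] S≗ refl with 7 ≤? m
    ... | yes 7≤m = inj₁ 7≤m
    ... | no  7≰m = inj₂ (m≡6 , Exception-resp (exception m m≡6 h≢0 2h r≢0 h≢r (Σₗ≡0 min (x ∷ h ⊞ r ∷ h ∷ r ∷ []) S≗)))
      where
      m≡6 : m ≡ 6
      m≡6 = ≤-antisym (ℕ.s≤s⁻¹ (≰⇒> 7≰m)) (atLeast⇒≤ six)

      r≢0 : r ≢ ε
      r≢0 = ∈⇒≢0 z (there (there (here refl)))

      Exception-resp : Exception m ⟦ x ∷ h ⊞ r ∷ h ∷ r ∷ [] ⟧ → Exception m S
      Exception-resp (inj₁ eq) = inj₁ (λ a → trans (S≗ a) (eq a))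
      Exception-resp (inj₂ eq) = inj₂ (λ a → trans (S≗ a) (eq a))

    main : suc (length W) + 3 + 3 ≤ m ⊎ (m ≡ 6 × Exception m S)
    main with q ≟ h ⊞ r
    ... | yes q≡h+r = exceptional W S≗′ q≡h+r
    ... | no  q≢h+r = inj₁ (subst (_≤ m) (arith₇ (length W)) (atLeast⇒≤ (grow-++ W zW
      (atLeast-↭ (swap h q refl) (atLeast-seven-involution u′ (zeroSumFree-↭ (swap q h refl) z) 2h q≢h+r)))))

  bound : ∀ {S : Multiset m} → MinimalZeroSum S → 3 ≤ σ S →
          (# S) + σ S ≤ m ⊎ (m ≡ 6 × Exception m S)
  bound {S} min 3≤ = subst₂ (λ n k → n + k ≤ m ⊎ (m ≡ 6 × Exception m S)) size width
      (bound-lists min excess support multiplicity unique (subst (3 ≤_) (sym width) 3≤))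
    where open Decomposition (decompose S)

  -- Supports of at most two elements.

  -- The excluded equation is #S + σ(S) = m + 1. If `W` has an element to remove, the rest would
  -- have more than `m` subset sums; if `W` is empty, `a ⊞ b` would be a nonzero involution in a
  -- group of order 5.
  both-excess : ∀ {S : Multiset m} → MinimalZeroSum S → ∀ {a b} W → a ≢ b →
                S ≗ ⟦ (a ∷ b ∷ W) ++ a ∷ b ∷ [] ⟧ → length W + 5 ≢ m
  both-excess min {a} {b} [] a≢b S≗ refl = odd (toℕ (a ⊞ b)) (toℕ-involution a+b≢0 2[a+b])
    where
    z : ZeroSumFree (b ∷ a ∷ b ∷ [])
    z = zeroSumFree-tail min S≗

    a+b≢0 : a ⊞ b ≢ ε
    a+b≢0 = pair≢0 {b ∷ a ∷ b ∷ []} z (there (here refl)) (here refl) a≢b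

    2[a+b] : Involution (a ⊞ b)
    2[a+b] = trans (assoc a b (a ⊞ b))
      (trans (cong (λ g → a ⊞ (b ⊞ (a ⊞ g))) (sym (identityʳ b))) (Σₗ≡0 min (a ∷ b ∷ a ∷ b ∷ []) S≗))

    odd : ∀ k → k + k ≢ 5
    odd (suc (suc (suc k))) eq with () ← trans (sym (cong (3 +_) (+-comm k (3 + k)))) eq
  both-excess min {a} {b} (x ∷ W) a≢b S≗ eq = 1+n≰n (subst (_≤ m) (trans (arith (length W)) (cong suc eq))
      (atLeast⇒≤ (grow-++ W z (atLeast-seven-pairs a≢b (zeroSumFree-drop W z)))))
    where
    z : ZeroSumFree (W ++ a ∷ b ∷ a ∷ b ∷ [])
    z = zeroSumFree-tail min (λ c → trans (S≗ c) (⟦⟧-↭ (shifts (a ∷ b ∷ []) (x ∷ W)) c))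

    arith : ∀ w → w + 7 ≡ suc (suc (w + 5))
    arith = solve-∀

  excess⊆support : ∀ {S : Multiset m} {W V} → S ≗ ⟦ W ++ V ⟧ → (∀ {a} → 1 ≤ S a → a ∈ₗ V) →
                   ∀ {w} → w ∈ₗ W → w ∈ₗ V
  excess⊆support {W = W} {V} S≗ complete {w} w∈W = complete (subst (1 ≤_)
    (sym (trans (S≗ w) (⟦⟧-++ W V w))) (≤-trans (∈⇒1≤ w∈W) (m≤m+n _ _)))

  excess<multiplicity : ∀ {S : Multiset m} {W V a} → S ≗ ⟦ W ++ V ⟧ → a ∈ₗ V → All (a ≡_) W → length W < S a
  excess<multiplicity {S} {W} {V} {a} S≗ a∈V all = begin
    suc (length W)     ≡⟨ +-comm 1 (length W) ⟩
    length W + 1       ≤⟨ +-mono-≤ (≤-reflexive (sym (⟦⟧-all all))) (∈⇒1≤ a∈V) ⟩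
    ⟦ W ⟧ a + ⟦ V ⟧ a  ≡⟨ ⟦⟧-++ W V a ⟨
    ⟦ W ++ V ⟧ a       ≡⟨ S≗ a ⟨
    S a                ∎
    where open ≤-Reasoning

  -- If all excess copies equal one element, its multiplicity is at least |W| + 1, and |W| ≥ m - 3
  -- as the support has at most two elements. Otherwise both elements occur in the excess, against
  -- `both-excess`.
  dominant : ∀ {S : Multiset m} → MinimalZeroSum S → ∀ W V → S ≗ ⟦ W ++ V ⟧ → Unique V →
             (∀ {a} → 1 ≤ S a → a ∈ₗ V) → length V ≤ 2 → (length W + length V) + length V ≡ m + 1 →
             ∃[ a ] (1 ≤ S a × m ∸ 2 ≤ S a)
  dominant {S} min W V S≗ u complete ≤2 size = go V S≗ u complete ≤2 size
    where
    witness : ∀ {a n} → length W < S a → n ≤ length W + 4 → n ≡ m + 1 → ∃[ a ] (1 ≤ S a × m ∸ 2 ≤ S a)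
    witness {a} W<Sa n≤ refl = a , ≤-trans (s≤s z≤n) W<Sa , ≤-trans (m≤n+o⇒m∸n≤o m 2 m≤) W<Sa
      where
      m≤ : m ≤ 2 + suc (length W)
      m≤ = +-cancelʳ-≤ 1 m _ (≤-trans n≤ (≤-reflexive (arith (length W))))
        where
        arith : ∀ w → w + 4 ≡ 2 + suc w + 1
        arith = solve-∀

    go : ∀ V → S ≗ ⟦ W ++ V ⟧ → Unique V → (∀ {a} → 1 ≤ S a → a ∈ₗ V) → length V ≤ 2 →
         (length W + length V) + length V ≡ m + 1 → ∃[ a ] (1 ≤ S a × m ∸ 2 ≤ S a)
    go [] S≗ u complete ≤2 size with () ← complete (proj₂ (proj₁ min))
    go (a ∷ []) S≗ u complete ≤2 size =
      witness (excess<multiplicity S≗ (here refl) (All.tabulate only))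
        (≤-trans (≤-reflexive (+-assoc (length W) 1 1)) (+-monoʳ-≤ (length W) (s≤s (s≤s z≤n)))) size
      where
      only : ∀ {w} → w ∈ₗ W → a ≡ w
      only w∈W with here eq ← excess⊆support {W = W} S≗ complete w∈W = sym eq
    go (a ∷ b ∷ []) S≗ ((a≢b ∷ []) ∷ _) complete ≤2 size with All.all? (a ≟_) W | All.all? (b ≟_) W
    ... | yes all | _ = witness (excess<multiplicity S≗ (here refl) all) (≤-reflexive (+-assoc (length W) 2 2)) size
    ... | no _ | yes all =
      witness (excess<multiplicity S≗ (there (here refl)) all) (≤-reflexive (+-assoc (length W) 2 2)) size
    -- Some excess element is not `a` and some is not `b`, so the excess contains both `b` and `a`.
    ... | no ¬a | no ¬b with find (¬All⇒Any¬ (a ≟_) W ¬a) | find (¬All⇒Any¬ (b ≟_) W ¬b)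
    ... | c , c∈W , a≢c | d , d∈W , b≢d
      with excess⊆support {W = W} S≗ complete c∈W | excess⊆support {W = W} S≗ complete d∈W
    ... | here refl | _ = contradiction refl a≢c
    ... | _ | there (here refl) = contradiction refl b≢d
    ... | there (here refl) | here refl with W₁ , p ← ∈⇒↭ d∈W with ∈-resp-↭ p c∈W
    ...   | here refl = contradiction refl a≢c
    ...   | there b∈W₁ with W₂ , q ← ∈⇒↭ b∈W₁ =
      contradiction length≡ (both-excess min W₂ a≢b (λ x → trans (S≗ x) (⟦⟧-↭ (++⁺ʳ (a ∷ b ∷ []) r) x)))
      where
      r : W ↭ a ∷ b ∷ W₂
      r = ↭-trans p (prep a q)

      arith : ∀ w → w + 5 + 1 ≡ suc (suc w) + 2 + 2
      arith = solve-∀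

      length≡ : length W₂ + 5 ≡ m
      length≡ = +-cancelʳ-≡ 1 _ _ (trans (arith (length W₂)) (trans (cong (λ n → n + 2 + 2) (sym (↭-length r))) size))
    go (_ ∷ _ ∷ _ ∷ _) S≗ u complete (s≤s (s≤s ())) size

-- Assembly of the three statements.

σ-cong : ∀ {m} {S T : Multiset m} → S ≗ T → σ S ≡ σ T
σ-cong S≗T = cong ∣_∣ (tabulate-cong (λ a → cong (λ n → does (1 ≤? n)) (S≗T a)))

exception-width : ∀ m .{{_ : NonZero m}} {S : Multiset m} → m ≡ 6 → Exception m S → σ S ≡ 3
exception-width .6 refl (inj₁ eq) = σ-cong eq
exception-width .6 refl (inj₂ eq) = σ-cong eq

1≤⇒∈supp : ∀ {m} {S : Multiset m} {a} → 1 ≤ S a → a ∈ supp S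
1≤⇒∈supp {S = S} {a} 1≤ = lookup⇒[]= a (supp S)
  (trans (lookup∘tabulate (λ b → does (1 ≤? S b)) a) (dec-true (1 ≤? S a) 1≤))

corollary3 : (m : ℕ) .{{_ : NonZero m}} → m ≥ 2 → (S : Multiset m) → MinimalZeroSum S →
    ((# S) + σ S ≡ m + 1 →
    (σ S ≤ 2 ⇔ (¬ (m ≡ 6 × (S ≗ ⟅ 1 ∷ 3 ∷ 4 ∷ 4 ∷ [] ⟆ ⊎ S ≗ ⟅ 2 ∷ 2 ∷ 3 ∷ 5 ∷ [] ⟆)))))
    × (m ≥ 3 → m ≢ 6 → (# S) + σ S ≡ m + 1 → ∃[ a ] (a ∈ supp S × S a ≥ m ∸ 2))
    × (m ≥ 7 → σ S ≥ 3 → (# S) ≤ m ∸ σ S)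
corollary3 m _ S min = part-i , part-ii , part-iii
  where
  open Decomposition (decompose S)

  narrow : (# S) + σ S ≡ m + 1 → ¬ (m ≡ 6 × Exception m S) → σ S ≤ 2
  narrow size ¬exc with σ S ≤? 2
  ... | yes σ≤2 = σ≤2
  ... | no  σ≰2 with bound min (≰⇒> σ≰2)
  ...   | inj₁ ≤m  = contradiction (subst (_≤ m) (trans size (+-comm m 1)) ≤m) 1+n≰n
  ...   | inj₂ exc = contradiction exc ¬exc

  part-i : (# S) + σ S ≡ m + 1 → σ S ≤ 2 ⇔ (¬ (m ≡ 6 × Exception m S))
  part-i size = mk⇔
    -- Both exceptional multisets have three different elements.
    (λ σ≤2 (m≡6 , exc) → contradiction (subst (_≤ 2) (exception-width m m≡6 exc) σ≤2) 1+n≰n)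
    (narrow size)

  part-ii : m ≥ 3 → m ≢ 6 → (# S) + σ S ≡ m + 1 → ∃[ a ] (a ∈ supp S × S a ≥ m ∸ 2)
  part-ii _ m≢6 eq with a , 1≤ , m∸2≤ ← dominant min excess support multiplicity unique complete
      (subst (_≤ 2) (sym width) (narrow eq (m≢6 ∘ proj₁)))
      (trans (cong₂ _+_ size width) eq) =
    a , 1≤⇒∈supp {S = S} 1≤ , m∸2≤

  part-iii : m ≥ 7 → σ S ≥ 3 → (# S) ≤ m ∸ σ S
  part-iii 7≤m 3≤σ with bound min 3≤σ
  ... | inj₁ ≤m         = m+n≤o⇒m≤o∸n (# S) ≤m
  ... | inj₂ (m≡6 , _) = contradiction (subst (7 ≤_) m≡6 7≤m) 1+n≰n
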